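{- For every positive integer $d$, there is a number $c_d\in(0,1)$ and a function $\beta_d:(c_d,1]\to(0,1]$ such that the following holds: for every $S\subset\mathbb{R}^d$, every $\alpha\in(c_d,1]$, and every finite family $F$ of axis-parallel boxes in $\mathbb{R}^d$, if at least $\alpha\binom{|F|}{2}$ of the pairs of $F$ are $S$-intersecting, then $F$ contains an $S$-intersecting subfamily of size at least $\beta_d(\alpha)|F|$.
   Context: An axis-parallel box in $\mathbb{R}^d$ is a product of $d$ closed intervals of $\mathbb{R}$ (only closed boxes are considered). Given a nonempty set $S$, a family of nonempty sets is $S$-intersecting if the intersection of all its members meets $S$. A pair of $F$ is a subfamily of two members.
   Formalization: Families with exactly one member are excluded: for |F| = 1 there are no pairs, so the hypothesis is vacuous, and the claim fails, e.g. for S = {0} and F = {[1,2]} in dimension 1. -}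

module Defs where

open import Algebra.Bundles.Raw using (RawMonoid)
import Algebra.Definitions.RawMonoid as RawMonoidDefinitions
open import Data.Fin.Base using (Fin)
open import Data.Fin.Subset using (Subset; ∣_∣) renaming (_∈_ to _∈ₛ_)
import Data.Integer.Base as ℤ
open import Data.List.Base using (List; length)
open import Data.List.Relation.Unary.All using (All)
open import Data.List.Relation.Unary.Unique.Propositional using (Unique)
open import Data.Nat.Base as ℕ using (ℕ)
open import Data.Product.Base using (Σ; ∃; ∃₂; _×_; _,_; proj₁; proj₂)
open import Data.Rational.Base as ℚ using (ℚ)
import Data.Rational.Properties as ℚ
open import Data.Sum.Base using (inj₁; inj₂)
open import Data.Vec.Functional using (Vector)
open import Function.Base using (id; _∘_)
open import Level using (Level; 0ℓ; suc)
open import Relation.Binary.Bundles using (Setoid)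
open import Relation.Binary.Core using (Rel)
open import Relation.Binary.Definitions using (tri<; tri≈; tri>)
open import Relation.Binary.PropositionalEquality using (_≡_; refl; sym; trans; cong; subst)
open import Relation.Nullary.Negation using (¬_; contradiction)
open import Relation.Unary using (Pred; _∈_; _∉_)

-- Dedekind's construction of the reals by lower cuts: a real is a nonempty
-- proper initial segment of ℚ without a greatest element.  Cuts are not
-- required to be located, so this is the usual field of real numbers only in
-- the presence of excluded middle.

record ℝ : Set₁ where
  field
    cut       : Pred ℚ 0ℓ
    nonempty  : ∃ λ q → q ∈ cut
    proper    : ∃ λ q → q ∉ cut
    downward  : ∀ {p q} → p ℚ.< q → q ∈ cut → p ∈ cut
    unrounded : ∀ {q} → q ∈ cut → ∃ λ r → q ℚ.< r × r ∈ cut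

open ℝ public

infix 4 _≤_ _<_ _≈_

_≤_ _<_ _≈_ : Rel ℝ 0ℓ
x ≤ y = ∀ {q} → q ∈ cut x → q ∈ cut y
x < y = ∃ λ q → q ∉ cut x × q ∈ cut y
x ≈ y = x ≤ y × y ≤ x

private
  q-1<q : ∀ q → q ℚ.- ℚ.1ℚ ℚ.< q
  q-1<q q = subst (q ℚ.- ℚ.1ℚ ℚ.<_) (ℚ.+-identityʳ q)
              (ℚ.+-monoʳ-< q (ℚ.negative⁻¹ (ℚ.- ℚ.1ℚ)))

  [p-s]+s≡p : ∀ p s → (p ℚ.- s) ℚ.+ s ≡ p
  [p-s]+s≡p p s = trans (ℚ.+-assoc p (ℚ.- s) s)
                    (trans (cong (p ℚ.+_) (ℚ.+-inverseˡ s)) (ℚ.+-identityʳ p))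

  [r+s]-s≡r : ∀ r s → (r ℚ.+ s) ℚ.- s ≡ r
  [r+s]-s≡r r s = trans (ℚ.+-assoc r s (ℚ.- s))
                    (trans (cong (r ℚ.+_) (ℚ.+-inverseʳ s)) (ℚ.+-identityʳ r))

  below : ∀ x {p q} → p ∈ cut x → q ∉ cut x → p ℚ.< q
  below x {p} {q} p∈x q∉x with ℚ.<-cmp p q
  ... | tri< p<q _ _ = p<q
  ... | tri≈ _ refl _ = contradiction p∈x q∉x
  ... | tri> _ _ q<p = contradiction (downward x q<p p∈x) q∉x

fromℚ : ℚ → ℝ
fromℚ q = record
  { cut       = ℚ._< q
  ; nonempty  = q ℚ.- ℚ.1ℚ , q-1<q q
  ; proper    = q , ℚ.<-irrefl refl
  ; downward  = ℚ.<-trans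
  ; unrounded = ℚ.<-dense
  }

fromℕ : ℕ → ℝ
fromℕ n = fromℚ (ℤ.+ n ℚ./ 1)

0ℝ 1ℝ : ℝ
0ℝ = fromℚ ℚ.0ℚ
1ℝ = fromℚ ℚ.1ℚ

infixl 6 _+_

_+_ : ℝ → ℝ → ℝ
x + y = record
  { cut       = λ q → ∃₂ λ r s → r ∈ cut x × s ∈ cut y × q ≡ r ℚ.+ s
  ; nonempty  = let (r , r∈x) = nonempty x; (s , s∈y) = nonempty y
                in r ℚ.+ s , r , s , r∈x , s∈y , refl
  ; proper    = let (r , r∉x) = proper x; (s , s∉y) = proper y
                in r ℚ.+ s , λ (r′ , s′ , r′∈x , s′∈y , eq) →
                     ℚ.<-irrefl (sym eq) (ℚ.+-mono-< (below x r′∈x r∉x) (below y s′∈y s∉y))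
  ; downward  = λ { {p} p<q (r , s , r∈x , s∈y , refl) →
                    p ℚ.- s , s
                    , downward x (subst (p ℚ.- s ℚ.<_) ([r+s]-s≡r r s) (ℚ.+-monoˡ-< (ℚ.- s) p<q)) r∈x
                    , s∈y , sym ([p-s]+s≡p p s) }
  ; unrounded = λ { (r , s , r∈x , s∈y , refl) →
                    let (r′ , r<r′ , r′∈x) = unrounded x r∈x
                    in r′ ℚ.+ s , ℚ.+-monoˡ-< s r<r′ , r′ , s , r′∈x , s∈y , refl }
  }

+-0-rawMonoid : RawMonoid (suc 0ℓ) 0ℓ
+-0-rawMonoid = record { Carrier = ℝ ; _≈_ = _≈_ ; _∙_ = _+_ ; ε = 0ℝ }

-- The product n · x of a natural number and a real, as an n-fold sum.  The
-- theorem multiplies reals only by cardinalities.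
open RawMonoidDefinitions +-0-rawMonoid public using () renaming (_×_ to infixr 8 _·_)

-- The half-open interval (a , 1].  Setoid maps ⟨ a ,1] ⟶ₛ ⟨ b ,1] are functions
-- (a , 1] → (b , 1]: they depend neither on the representative of a real nor on
-- the proof that it lies in the interval.
⟨_,1] : ℝ → Setoid (suc 0ℓ) 0ℓ
⟨ a ,1] = record
  { Carrier       = ∃ λ x → a < x × x ≤ 1ℝ
  ; _≈_           = λ x y → proj₁ x ≈ proj₁ y
  ; isEquivalence = record
    { refl  = id , id
    ; sym   = λ (x≤y , y≤x) → y≤x , x≤y
    ; trans = λ (x≤y , y≤x) (y≤z , z≤y) → y≤z ∘ x≤y , y≤x ∘ z≤y
    }
  }

ℝ^ : ℕ → Set₁
ℝ^ d = Vector ℝ d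

infix 4 _≋_

_≋_ : ∀ {d} → Rel (ℝ^ d) 0ℓ
x ≋ y = ∀ i → x i ≈ y i

record ClosedInterval : Set₁ where
  field
    lo hi : ℝ
    lo≤hi : lo ≤ hi

open ClosedInterval public

Box : ℕ → Set₁
Box d = Vector ClosedInterval d

infix 4 _∈ᵇ_

_∈ᵇ_ : ∀ {d} → ℝ^ d → Box d → Set
x ∈ᵇ B = ∀ i → lo (B i) ≤ x i × x i ≤ hi (B i)

-- A finite family of boxes is a vector F of boxes (repetitions are allowed), and
-- a subfamily of it is a set of indices.

module _ {s : Level} {d n : ℕ} (S : Pred (ℝ^ d) s) (F : Vector (Box d) n) where

  Intersecting : Subset n → Set (suc 0ℓ Level.⊔ s)
  Intersecting I = ∃ λ x → x ∈ S × (∀ i → i ∈ₛ I → x ∈ᵇ F i)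

  -- At least t pairs of F, for a real number t, are S-intersecting.
  IntersectingPairs≥ : ℝ → Set (suc 0ℓ Level.⊔ s)
  IntersectingPairs≥ t =
    ∃ λ (Ps : List (Subset n)) →
      Unique Ps ×
      All (λ P → ∣ P ∣ ≡ 2 × Intersecting P) Ps ×
      t ≤ fromℕ (length Ps)

{-# OPTIONS --safe #-}

-- Choose a point p(x,z) of S in the intersection of each S-intersecting pair
-- {x , z}, and call (x , y , z) bad if {x , z} is not such a pair or if p(x,z)
-- lies in the box y.  Colour a pair of boxes by the directions in which the 2d
-- bounds change from the first to the second.  Among K = 2^(4^d) + 1 boxes in any
-- order some x, y, z, in this order, have the same colour on (x , y) and (y , z);
-- then each bound of y is at most as strict as that of x or that of z, hence
-- p(x,z) lies in y.  So every K-tuple contains a bad triple, and by averaging the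
-- proportion of bad triples is at least 1 / (K C 3).  If all but a small part of
-- the pairs are S-intersecting, then most of these bad triples come from points
-- p(x,z), and one such point lies in a positive proportion of the boxes.

module Submission where

open import Defs
open import Axiom.ExcludedMiddle using (ExcludedMiddle)
open import Data.Fin.Base as Fin using (Fin; zero; suc; combine; finToFun; funToFin)
import Data.Fin.Properties as Fin
open import Data.Fin.Subset using (Subset; ∣_∣; ⁅_⁆; _∪_; inside; outside; ⊥) renaming (_∈_ to _∈ₛ_)
import Data.Fin.Subset.Properties as Subset
import Data.Integer.Base as ℤ
import Data.Integer.Properties as ℤ
open import Data.Integer.Solver renaming (module +-*-Solver to ℤ-Solver)
open import Data.List.Base using (List; []; _∷_; length)
open import Data.List.Relation.Unary.All as All using (All; []; _∷_)
open import Data.List.Relation.Unary.AllPairs using ([]; _∷_)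
open import Data.List.Relation.Unary.Unique.Propositional using (Unique)
open import Data.Nat.Base as ℕ using (ℕ; NonZero; zero; suc; _*_; _^_; z≤n; s≤s)
open import Data.Nat.Combinatorics using (_C_; nC1≡n; nCn≡1; nCk≡nC[n∸k]; nCk+nC[k+1]≡[n+1]C[k+1])
import Data.Nat.Properties as ℕ
open import Data.Nat.Solver using (module +-*-Solver)
open import Data.Product.Base using (Σ; ∃; ∃₂; _×_; _,_; proj₁; proj₂)
open import Data.Rational.Base as ℚ using (ℚ; toℚᵘ)
import Data.Rational.Properties as ℚ
open import Data.Rational.Unnormalised.Base as ℚᵘ using (mkℚᵘ; *≡*; *≤*; *<*)
import Data.Rational.Unnormalised.Properties as ℚᵘ
open import Data.Sum.Base using (inj₁; inj₂)
open import Data.Vec.Base using (Vec; []; _∷_; lookup; tabulate)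
open import Data.Vec.Functional using (Vector)
open import Data.Vec.Properties using (lookup∘tabulate; []=⇒lookup)
open import Function.Base using (_∘_; _$_; id)
open import Function.Bundles using (_⟶ₛ_; _⟨$⟩_)
open import Level using (Level)
open import Relation.Binary.Bundles using (Setoid)
open import Relation.Binary.Definitions using (_Respects_; tri<; tri≈; tri>)
open import Relation.Binary.PropositionalEquality
  using (_≡_; _≢_; _≗_; refl; sym; trans; cong; cong₂; subst; subst₂; module ≡-Reasoning)
open import Relation.Nullary.Decidable using (Dec; yes; no; does; _×-dec_; ¬?)
open import Relation.Nullary.Negation using (¬_; contradiction)
open import Relation.Unary using (Pred; Satisfiable; _∈_)
open import Algebra.Properties.Semiring.Sum ℕ.+-*-semiring
  using (sum; ∑-comm; ∑-distrib-+; *-distribˡ-sum; sum-cong-≗)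

-- Colourings and monochromatic paths

bit : ∀ {p} {P : Set p} → Dec P → Fin 2
bit (yes _) = suc zero
bit (no _)  = zero

bit-transfer : ∀ {p q} {P : Set p} {Q : Set q} {P? : Dec P} {Q? : Dec Q} → bit P? ≡ bit Q? → P → Q
bit-transfer {P? = no ¬p} _ p = contradiction p ¬p
bit-transfer {P? = yes _} {yes q} _ _ = q

-- Equal bits make `P` and `Q` equivalent, so if `P` fails then `Q` fails too.
bit-cases : ∀ {p q r} {P : Set p} {Q : Set q} {R : Set r} {P? : Dec P} {Q? : Dec Q} →
            bit P? ≡ bit Q? → (P → R) → (¬ Q → R) → R
bit-cases {P? = yes p}              _ f g = f p
bit-cases {P? = no _}  {Q? = no ¬q} _ f g = g ¬q

funToFin-injective : ∀ {m n} {f g : Fin m → Fin n} → funToFin f ≡ funToFin g → f ≗ g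
funToFin-injective {f = f} {g} eq i = trans (sym (Fin.finToFun-funToFin f i))
  (trans (cong (λ e → finToFun e i) eq) (Fin.finToFun-funToFin g i))

-- Otherwise the set of colours on the pairs (j , k) with k > j determines j:
-- for i < j, the colour of (i , j) would be such a colour for i but not for j.
monochromatic-path : ∀ {c} (χ : Fin (suc (2 ^ c)) → Fin (suc (2 ^ c)) → Fin c) →
  ∃ λ i → ∃₂ λ j k → i Fin.< j × j Fin.< k × χ i j ≡ χ j k
monochromatic-path {c} χ =
  let (i , j , i<j , eq) = Fin.pigeonhole (ℕ.n<1+n _) (funToFin ∘ out)
      (k , j<k , χjk≡χij) = bit-transfer (funToFin-injective eq (χ i j)) (j , i<j , refl)
  in i , j , k , i<j , j<k , sym χjk≡χij
  where
  Out = λ j a → ∃ λ k → j Fin.< k × χ j k ≡ a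

  out? : ∀ j a → Dec (Out j a)
  out? j a = Fin.any? λ k → (j Fin.<? k) ×-dec (χ j k Fin.≟ a)

  out : Fin (suc (2 ^ c)) → Fin c → Fin 2
  out j a = bit (out? j a)

-- Indicators and finite sums

⟦_⟧ : ∀ {p} {P : Set p} → Dec P → ℕ
⟦ yes _ ⟧ = 1
⟦ no _ ⟧  = 0

⟦⟧-mono : ∀ {p q} {P : Set p} {Q : Set q} {P? : Dec P} {Q? : Dec Q} → (P → Q) → ⟦ P? ⟧ ℕ.≤ ⟦ Q? ⟧
⟦⟧-mono {P? = no _}  P⇒Q = z≤n
⟦⟧-mono {P? = yes p} {Q? = yes _} P⇒Q = ℕ.≤-refl
⟦⟧-mono {P? = yes p} {Q? = no ¬q} P⇒Q = contradiction (P⇒Q p) ¬q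

⟦⟧-true : ∀ {p} {P : Set p} {P? : Dec P} → P → ⟦ P? ⟧ ≡ 1
⟦⟧-true {P? = yes _} p = refl
⟦⟧-true {P? = no ¬p} p = contradiction p ¬p

⟦⟧-complement : ∀ {p} {P : Set p} (P? : Dec P) → ⟦ P? ⟧ ℕ.+ ⟦ ¬? P? ⟧ ≡ 1
⟦⟧-complement (yes _) = refl
⟦⟧-complement (no _)  = refl

⟦⟧-< : ∀ {p q} {P : Set p} {Q : Set q} {P? : Dec P} {Q? : Dec Q} → ¬ P → Q → ⟦ P? ⟧ ℕ.< ⟦ Q? ⟧
⟦⟧-< {P? = yes p} ¬p q = contradiction p ¬p
⟦⟧-< {P? = no _} {Q? = yes _} ¬p q = ℕ.≤-refl
⟦⟧-< {P? = no _} {Q? = no ¬q} ¬p q = contradiction q ¬q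

sum-const : ∀ n a → sum {n} (λ _ → a) ≡ n * a
sum-const zero    a = refl
sum-const (suc n) a = cong (a ℕ.+_) (sum-const n a)

sum-mono-≤ : ∀ {n} {f g : Vector ℕ n} → (∀ i → f i ℕ.≤ g i) → sum f ℕ.≤ sum g
sum-mono-≤ {zero}  f≤g = z≤n
sum-mono-≤ {suc n} f≤g = ℕ.+-mono-≤ (f≤g zero) (sum-mono-≤ (f≤g ∘ suc))

sum-mono-< : ∀ {n} {f g : Vector ℕ n} → (∀ i → f i ℕ.≤ g i) → ∀ a → f a ℕ.< g a → sum f ℕ.< sum g
sum-mono-< f≤g zero    fa<ga = ℕ.+-mono-<-≤ fa<ga (sum-mono-≤ (f≤g ∘ suc))
sum-mono-< f≤g (suc a) fa<ga = ℕ.+-mono-≤-< (f≤g zero) (sum-mono-< (f≤g ∘ suc) a fa<ga)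

-- Meant for the row sums of a double sum: the two orderings of a pair lie in different rows, and
-- each contributes a unit.
sum-mono-<₂ : ∀ {n} {f g : Vector ℕ n} → (∀ i → f i ℕ.≤ g i) →
              ∀ {a b} → a ≢ b → f a ℕ.< g a → f b ℕ.< g b → 2 ℕ.+ sum f ℕ.≤ sum g
sum-mono-<₂ f≤g {zero}  {zero}  a≢b fa<ga fb<gb = contradiction refl a≢b
sum-mono-<₂ {f = f} {g} f≤g {zero}  {suc b} a≢b fa<ga fb<gb =
  subst (ℕ._≤ sum g) (cong suc (ℕ.+-suc (f zero) _)) (ℕ.+-mono-≤ fa<ga (sum-mono-< (f≤g ∘ suc) b fb<gb))
sum-mono-<₂ {f = f} {g} f≤g {suc a} {zero}  a≢b fa<ga fb<gb =
  subst (ℕ._≤ sum g) (cong suc (ℕ.+-suc (f zero) _)) (ℕ.+-mono-≤ fb<gb (sum-mono-< (f≤g ∘ suc) a fa<ga))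
sum-mono-<₂ {f = f} {g} f≤g {suc a} {suc b} a≢b fa<ga fb<gb =
  subst (ℕ._≤ sum g) (trans (ℕ.+-suc (f zero) _) (cong suc (ℕ.+-suc (f zero) _)))
    (ℕ.+-mono-≤ (f≤g zero) (sum-mono-<₂ (f≤g ∘ suc) (a≢b ∘ cong suc) fa<ga fb<gb))

-- Sums over tuples and subsequences, and averaging

sumVec : ∀ {n} k → (Vec (Fin n) k → ℕ) → ℕ
sumVec zero    f = f []
sumVec (suc k) f = sum λ x → sumVec k (f ∘ (x ∷_))

sumVec-const : ∀ {n} k a → sumVec {n} k (λ _ → a) ≡ n ^ k * a
sumVec-const     zero    a = sym (ℕ.+-identityʳ a)
sumVec-const {n} (suc k) a = begin
  sum {n} (λ _ → sumVec k (λ _ → a)) ≡⟨ sum-const n _ ⟩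
  n * sumVec k (λ _ → a)              ≡⟨ cong (n *_) (sumVec-const k a) ⟩
  n * (n ^ k * a)                     ≡⟨ ℕ.*-assoc n (n ^ k) a ⟨
  n ^ suc k * a                       ∎
  where open ≡-Reasoning

sumVec-mono-≤ : ∀ {n} k {f g : Vec (Fin n) k → ℕ} → (∀ v → f v ℕ.≤ g v) → sumVec k f ℕ.≤ sumVec k g
sumVec-mono-≤ zero    f≤g = f≤g []
sumVec-mono-≤ (suc k) f≤g = sum-mono-≤ λ x → sumVec-mono-≤ k (f≤g ∘ (x ∷_))

sumVec-distrib-+ : ∀ {n} k (f g : Vec (Fin n) k → ℕ) →
                   sumVec k (λ v → f v ℕ.+ g v) ≡ sumVec k f ℕ.+ sumVec k g
sumVec-distrib-+ zero    f g = refl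
sumVec-distrib-+ (suc k) f g =
  trans (sum-cong-≗ λ x → sumVec-distrib-+ k (f ∘ (x ∷_)) (g ∘ (x ∷_)))
    (∑-distrib-+ (λ x → sumVec k (f ∘ (x ∷_))) (λ x → sumVec k (g ∘ (x ∷_))))

-- Subsequences are taken by position, so there are `k C r` terms even if entries of the vector
-- repeat.
sumSub : ∀ {A : Set} r {k} → (Vec A r → ℕ) → Vec A k → ℕ
sumSub zero    f v       = f []
sumSub (suc r) f []      = 0
sumSub (suc r) f (x ∷ v) = sumSub r (f ∘ (x ∷_)) v ℕ.+ sumSub (suc r) f v

module _ {A : Set} where

  sumSub-term₁ : ∀ {k} (f : Vec A 1 → ℕ) (v : Vec A k) i → f (lookup v i ∷ []) ℕ.≤ sumSub 1 f v
  sumSub-term₁ f (x ∷ v) zero    = ℕ.m≤m+n _ _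
  sumSub-term₁ f (x ∷ v) (suc i) = ℕ.m≤n⇒m≤o+n _ (sumSub-term₁ f v i)

  sumSub-term₂ : ∀ {k} (f : Vec A 2 → ℕ) (v : Vec A k) {i j} → i Fin.< j →
                 f (lookup v i ∷ lookup v j ∷ []) ℕ.≤ sumSub 2 f v
  sumSub-term₂ f (x ∷ v) {zero}  {suc j} _         = ℕ.m≤n⇒m≤n+o _ (sumSub-term₁ (f ∘ (x ∷_)) v j)
  sumSub-term₂ f (x ∷ v) {suc i} {suc j} (s≤s i<j) = ℕ.m≤n⇒m≤o+n _ (sumSub-term₂ f v i<j)

  sumSub-term₃ : ∀ {k} (f : Vec A 3 → ℕ) (v : Vec A k) {i j l} → i Fin.< j → j Fin.< l →
                 f (lookup v i ∷ lookup v j ∷ lookup v l ∷ []) ℕ.≤ sumSub 3 f v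
  sumSub-term₃ f (x ∷ v) {zero}  {suc j} {suc l} _         (s≤s j<l) =
    ℕ.m≤n⇒m≤n+o _ (sumSub-term₂ (f ∘ (x ∷_)) v j<l)
  sumSub-term₃ f (x ∷ v) {suc i} {suc j} {suc l} (s≤s i<j) (s≤s j<l) =
    ℕ.m≤n⇒m≤o+n _ (sumSub-term₃ f v i<j j<l)

nC0≡1 : ∀ n → n C 0 ≡ 1
nC0≡1 n = trans (nCk≡nC[n∸k] {n = n} z≤n) (nCn≡1 n)

-- Double counting: for each of the `k C r` choices of positions, every `r`-tuple extends to a
-- `k`-tuple in `n ^ (k - r)` ways. The factor `n ^ r` on the left avoids the subtraction. The
-- induction splits on whether the first position is chosen, and Pascal's rule adds the two counts.
sumVec-sumSub : ∀ {n} r k (f : Vec (Fin n) r → ℕ) →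
                n ^ r * sumVec k (sumSub r f) ≡ (k C r) * n ^ k * sumVec r f
sumVec-sumSub {n} zero k f = begin
  1 * sumVec k (λ _ → f []) ≡⟨ ℕ.*-identityˡ _ ⟩
  sumVec k (λ _ → f [])     ≡⟨ sumVec-const k (f []) ⟩
  n ^ k * f []              ≡⟨ cong (_* f []) (ℕ.*-identityˡ (n ^ k)) ⟨
  1 * n ^ k * f []          ≡⟨ cong (λ e → e * n ^ k * f []) (nC0≡1 k) ⟨
  (k C 0) * n ^ k * f []    ∎
  where open ≡-Reasoning
sumVec-sumSub {n} (suc r) zero f = ℕ.*-zeroʳ (n ^ suc r)
sumVec-sumSub {n} (suc r) (suc k) f = begin
  n * n ^ r * sum (λ x → sumVec k (λ v → sumSub r (f ∘ (x ∷_)) v ℕ.+ sumSub (suc r) f v))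
    ≡⟨ cong (n * n ^ r *_) (sum-cong-≗ λ x → sumVec-distrib-+ k (sumSub r (f ∘ (x ∷_))) (sumSub (suc r) f)) ⟩
  n * n ^ r * sum (λ x → A x ℕ.+ B)
    ≡⟨ cong (n * n ^ r *_) (∑-distrib-+ A (λ _ → B)) ⟩
  n * n ^ r * (sum A ℕ.+ sum {n} (λ _ → B))
    ≡⟨ cong (λ e → n * n ^ r * (sum A ℕ.+ e)) (sum-const n B) ⟩
  n * n ^ r * (sum A ℕ.+ n * B)
    ≡⟨ solve 4 (λ n p a b → n :* p :* (a :+ n :* b) := n :* (p :* a) :+ n :* (n :* p :* b))
         refl n (n ^ r) (sum A) B ⟩
  n * (n ^ r * sum A) ℕ.+ n * (n ^ suc r * B)
    ≡⟨ cong₂ (λ a b → n * a ℕ.+ n * b) sum-A (sumVec-sumSub (suc r) k f) ⟩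
  n * ((k C r) * n ^ k * T) ℕ.+ n * ((k C suc r) * n ^ k * T)
    ≡⟨ solve 5 (λ n c d p t → n :* (c :* p :* t) :+ n :* (d :* p :* t) := (c :+ d) :* (n :* p) :* t)
         refl n (k C r) (k C suc r) (n ^ k) T ⟩
  (k C r ℕ.+ k C suc r) * (n * n ^ k) * T
    ≡⟨ cong (λ e → e * n ^ suc k * T) (nCk+nC[k+1]≡[n+1]C[k+1] k r) ⟩
  (suc k C suc r) * n ^ suc k * T ∎
  where
  open ≡-Reasoning
  open +-*-Solver using (solve; _:=_; _:+_; _:*_)
  A = λ x → sumVec k (sumSub r (f ∘ (x ∷_)))
  B = sumVec k (sumSub (suc r) f)
  T = sumVec (suc r) f
  sum-A : n ^ r * sum A ≡ (k C r) * n ^ k * T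
  sum-A = trans (*-distribˡ-sum (n ^ r) A)
    (trans (sum-cong-≗ λ x → sumVec-sumSub r k (f ∘ (x ∷_)))
      (sym (*-distribˡ-sum ((k C r) * n ^ k) λ x → sumVec r (f ∘ (x ∷_)))))

-- The hypothesis bounds the sum over all `k`-tuples below by `n ^ k`; the double count then allows
-- cancelling `n ^ k`.
averaging : ∀ {n} .{{_ : NonZero n}} r k (f : Vec (Fin n) r → ℕ) →
            (∀ (v : Vec (Fin n) k) → 1 ℕ.≤ sumSub r f v) → n ^ r ℕ.≤ (k C r) * sumVec r f
averaging {n} r k f 1≤sumSub = ℕ.*-cancelʳ-≤ _ _ (n ^ k) {{ℕ.m^n≢0 n k}} $ begin
  n ^ r * n ^ k                      ≡⟨ cong (n ^ r *_) (ℕ.*-identityʳ (n ^ k)) ⟨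
  n ^ r * (n ^ k * 1)                ≡⟨ cong (n ^ r *_) (sumVec-const k 1) ⟨
  n ^ r * sumVec {n} k (λ _ → 1)     ≤⟨ ℕ.*-monoʳ-≤ (n ^ r) (sumVec-mono-≤ k 1≤sumSub) ⟩
  n ^ r * sumVec k (sumSub r f)      ≡⟨ sumVec-sumSub r k f ⟩
  (k C r) * n ^ k * sumVec r f       ≡⟨ solve 3 (λ c p t → c :* p :* t := c :* t :* p)
                                          refl (k C r) (n ^ k) (sumVec r f) ⟩
  (k C r) * sumVec r f * n ^ k       ∎
  where
  open ℕ.≤-Reasoning
  open +-*-Solver using (solve; _:=_; _:*_)

-- Two-element subsets and ordered pairs

2*nC2+n≡n² : ∀ n → 2 * (n C 2) ℕ.+ n ≡ n * n
2*nC2+n≡n² zero    = refl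
2*nC2+n≡n² (suc n) = begin
  2 * (suc n C 2) ℕ.+ suc n                   ≡⟨ cong (λ e → 2 * e ℕ.+ suc n) (nCk+nC[k+1]≡[n+1]C[k+1] n 1) ⟨
  2 * (n C 1 ℕ.+ n C 2) ℕ.+ suc n             ≡⟨ cong (λ e → 2 * (e ℕ.+ n C 2) ℕ.+ suc n) (nC1≡n n) ⟩
  2 * (n ℕ.+ n C 2) ℕ.+ suc n                 ≡⟨ solve 2 (λ n c → con 2 :* (n :+ c) :+ (con 1 :+ n)
                                                              := con 2 :* c :+ n :+ (con 1 :+ n :+ n))
                                                   refl n (n C 2) ⟩
  2 * (n C 2) ℕ.+ n ℕ.+ (1 ℕ.+ n ℕ.+ n)       ≡⟨ cong (ℕ._+ (1 ℕ.+ n ℕ.+ n)) (2*nC2+n≡n² n) ⟩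
  n * n ℕ.+ (1 ℕ.+ n ℕ.+ n)                   ≡⟨ solve 1 (λ n → n :* n :+ (con 1 :+ n :+ n)
                                                            := (con 1 :+ n) :* (con 1 :+ n)) refl n ⟩
  suc n * suc n                               ∎
  where
  open ≡-Reasoning
  open +-*-Solver using (solve; _:=_; _:+_; _:*_; con)

∣p∣≡0⇒p≡⊥ : ∀ {n} {p : Subset n} → ∣ p ∣ ≡ 0 → p ≡ ⊥
∣p∣≡0⇒p≡⊥ {p = []}          _  = refl
∣p∣≡0⇒p≡⊥ {p = outside ∷ p} eq = cong (outside ∷_) (∣p∣≡0⇒p≡⊥ eq)

∣p∣≡1⇒p≡⁅x⁆ : ∀ {n} {p : Subset n} → ∣ p ∣ ≡ 1 → ∃ λ x → p ≡ ⁅ x ⁆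
∣p∣≡1⇒p≡⁅x⁆ {p = outside ∷ p} eq = let (x , p≡) = ∣p∣≡1⇒p≡⁅x⁆ eq in suc x , cong (outside ∷_) p≡
∣p∣≡1⇒p≡⁅x⁆ {p = inside  ∷ p} eq = zero , cong (inside ∷_) (∣p∣≡0⇒p≡⊥ (ℕ.suc-injective eq))

∣p∣≡2⇒p≡⁅x⁆∪⁅y⁆ : ∀ {n} {p : Subset n} → ∣ p ∣ ≡ 2 → ∃₂ λ x y → x ≢ y × p ≡ ⁅ x ⁆ ∪ ⁅ y ⁆
∣p∣≡2⇒p≡⁅x⁆∪⁅y⁆ {p = outside ∷ p} eq =
  let (x , y , x≢y , p≡) = ∣p∣≡2⇒p≡⁅x⁆∪⁅y⁆ eq
  in suc x , suc y , x≢y ∘ Fin.suc-injective , cong (outside ∷_) p≡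
∣p∣≡2⇒p≡⁅x⁆∪⁅y⁆ {p = inside ∷ p} eq =
  let (y , p≡) = ∣p∣≡1⇒p≡⁅x⁆ (ℕ.suc-injective eq)
  in zero , suc y , (λ ()) , cong (inside ∷_) (trans p≡ (sym (Subset.∪-identityˡ _)))

module _ (em : ∀ {ℓ} → ExcludedMiddle ℓ) where

  -- Induction on the list. Each head `⁅ a ⁆ ∪ ⁅ b ⁆` is responsible for the two ordered pairs
  -- `(a , b)` and `(b , a)`.
  ordered-pairs : ∀ {n q} (Q : Pred (Subset n) q) {Ps : List (Subset n)} → Unique Ps →
    All (λ P → ∣ P ∣ ≡ 2 × Q P) Ps →
    2 * length Ps ℕ.≤ sum λ x → sum λ y → ⟦ em {P = x ≢ y × Q (⁅ x ⁆ ∪ ⁅ y ⁆)} ⟧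
  ordered-pairs Q [] [] = z≤n
  ordered-pairs {n} Q {P ∷ Ps} (P≢Ps ∷ Ps!) ((∣P∣≡2 , QP) ∷ QPs) with ∣p∣≡2⇒p≡⁅x⁆∪⁅y⁆ {p = P} ∣P∣≡2
  ... | a , b , a≢b , refl = begin
    2 * suc (length Ps)                       ≡⟨ ℕ.*-suc 2 (length Ps) ⟩
    2 ℕ.+ 2 * length Ps                       ≤⟨ ℕ.+-monoʳ-≤ 2 (ordered-pairs Q′ Ps! Q′Ps) ⟩
    2 ℕ.+ (sum λ x → sum λ y → #pairs Q′ x y) ≤⟨ sum-mono-<₂ (λ x → sum-mono-≤ (mono x)) a≢b
                                                   (sum-mono-< (mono a) b ab) (sum-mono-< (mono b) a ba) ⟩
    (sum λ x → sum λ y → #pairs Q x y)        ∎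
    where
    open ℕ.≤-Reasoning
    -- Excluding `P` keeps all of the tail, since the list has no repetitions, and removes both
    -- orderings of `P` from the count.
    Q′ : Pred (Subset n) _
    Q′ R = Q R × R ≢ P
    #pairs : ∀ {q} → Pred (Subset n) q → Fin n → Fin n → ℕ
    #pairs R x y = ⟦ em {P = x ≢ y × R (⁅ x ⁆ ∪ ⁅ y ⁆)} ⟧
    mono : ∀ x y → #pairs Q′ x y ℕ.≤ #pairs Q x y
    mono x y = ⟦⟧-mono λ (x≢y , QR , _) → x≢y , QR
    Q′Ps : All (λ R → ∣ R ∣ ≡ 2 × Q′ R) Ps
    Q′Ps = All.zipWith (λ (P≢R , ∣R∣≡2 , QR) → ∣R∣≡2 , QR , P≢R ∘ sym) (P≢Ps , QPs)
    ab : #pairs Q′ a b ℕ.< #pairs Q a b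
    ab = ⟦⟧-< (λ (_ , _ , ≢P) → ≢P refl) (a≢b , QP)
    ba : #pairs Q′ b a ℕ.< #pairs Q b a
    ba = ⟦⟧-< (λ (_ , _ , ≢P) → ≢P (Subset.∪-comm ⁅ b ⁆ ⁅ a ⁆))
              (a≢b ∘ sym , subst Q (Subset.∪-comm ⁅ a ⁆ ⁅ b ⁆) QP)

-- Fractions and cuts of multiples

frac : ℕ → ℕ → ℚ
frac a m = ℤ.+ a ℚ./ suc m

toℚᵘ-frac : ∀ a m → toℚᵘ (frac a m) ℚᵘ.≃ mkℚᵘ (ℤ.+ a) m
toℚᵘ-frac a m = ℚ.toℚᵘ-fromℚᵘ (mkℚᵘ (ℤ.+ a) m)

frac-+ : ∀ a b m → frac a m ℚ.+ frac b m ≡ frac (a ℕ.+ b) m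
frac-+ a b m = ℚ.toℚᵘ-injective (begin-equality
  toℚᵘ (frac a m ℚ.+ frac b m)           ≃⟨ ℚ.toℚᵘ-homo-+ (frac a m) (frac b m) ⟩
  toℚᵘ (frac a m) ℚᵘ.+ toℚᵘ (frac b m)   ≃⟨ ℚᵘ.+-cong (toℚᵘ-frac a m) (toℚᵘ-frac b m) ⟩
  mkℚᵘ (ℤ.+ a) m ℚᵘ.+ mkℚᵘ (ℤ.+ b) m     ≃⟨ *≡* (solve 3 (λ a b d → (a :* d :+ b :* d) :* d := (a :+ b) :* (d :* d))
                                                    refl (ℤ.+ a) (ℤ.+ b) (ℤ.+ suc m)) ⟩
  mkℚᵘ (ℤ.+ (a ℕ.+ b)) m                 ≃⟨ toℚᵘ-frac (a ℕ.+ b) m ⟨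
  toℚᵘ (frac (a ℕ.+ b) m)                ∎)
  where
  open ℚᵘ.≤-Reasoning
  open ℤ-Solver using (solve; _:=_; _:+_; _:*_)

frac-mono-≤ : ∀ a m b n → a * suc n ℕ.≤ b * suc m → frac a m ℚ.≤ frac b n
frac-mono-≤ a m b n le = ℚ.toℚᵘ-cancel-≤ (begin
  toℚᵘ (frac a m) ≃⟨ toℚᵘ-frac a m ⟩
  mkℚᵘ (ℤ.+ a) m  ≤⟨ *≤* (subst₂ ℤ._≤_ (ℤ.pos-* a (suc n)) (ℤ.pos-* b (suc m)) (ℤ.+≤+ le)) ⟩
  mkℚᵘ (ℤ.+ b) n  ≃⟨ toℚᵘ-frac b n ⟨
  toℚᵘ (frac b n) ∎)
  where open ℚᵘ.≤-Reasoning

frac-mono-< : ∀ a m b n → a * suc n ℕ.< b * suc m → frac a m ℚ.< frac b n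
frac-mono-< a m b n lt = ℚ.toℚᵘ-cancel-< (begin-strict
  toℚᵘ (frac a m) ≃⟨ toℚᵘ-frac a m ⟩
  mkℚᵘ (ℤ.+ a) m  <⟨ *<* (subst₂ ℤ._<_ (ℤ.pos-* a (suc n)) (ℤ.pos-* b (suc m)) (ℤ.+<+ lt)) ⟩
  mkℚᵘ (ℤ.+ b) n  ≃⟨ toℚᵘ-frac b n ⟨
  toℚᵘ (frac b n) ∎)
  where open ℚᵘ.≤-Reasoning

frac-cancel-< : ∀ a m b n → frac a m ℚ.< frac b n → a * suc n ℕ.< b * suc m
frac-cancel-< a m b n lt = ℕ.≰⇒> λ le →
  ℚ.<-irrefl refl (ℚ.<-≤-trans lt (frac-mono-≤ b n a m le))

-- The multiplier is a successor because zero does not belong to the cut of `0 · x`.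
·-lower : ∀ x a m n → frac a m ∈ cut x → frac (suc n * a) m ∈ cut (suc n · x)
·-lower x a m zero a∈x =
  -- `1 · x` is `x + 0ℝ`, so a strictly negative second summand is required; a larger element `r` of
  -- the cut leaves room for it.
  let (r , a<r , r∈x) = unrounded x a∈x
      p = frac a m
  in r , p ℚ.- r , r∈x
     , subst (p ℚ.- r ℚ.<_) (ℚ.+-inverseʳ r) (ℚ.+-monoˡ-< (ℚ.- r) a<r)
     , trans (cong (λ e → frac e m) (ℕ.*-identityˡ a)) (p≡r+[p-r] p r)
  where
  p≡r+[p-r] : ∀ p r → p ≡ r ℚ.+ (p ℚ.- r)
  p≡r+[p-r] p r = sym (trans (ℚ.+-comm r (p ℚ.- r)) (trans (ℚ.+-assoc p (ℚ.- r) r)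
    (trans (cong (p ℚ.+_) (ℚ.+-inverseˡ r)) (ℚ.+-identityʳ p))))
·-lower x a m (suc n) a∈x =
  frac a m , frac (suc n * a) m , a∈x , ·-lower x a m n a∈x , sym (frac-+ a (suc n * a) m)

·-upper : ∀ m {q} n → q ∈ cut (n · fromℚ (frac 1 m)) → q ℚ.< frac n m
·-upper m zero q<0 = subst (_ ℚ.<_) (sym (ℚ.0/n≡0 (suc m))) q<0
·-upper m (suc n) (r , s , r<1/m , s∈ , refl) =
  subst (r ℚ.+ s ℚ.<_) (frac-+ 1 n m) (ℚ.+-mono-< r<1/m (·-upper m n s∈))

-- Cuts are initial segments: an element of `y` outside `x` lies above all of `x`, which puts `x`
-- inside `y`.
≰⇒≥ : (∀ {ℓ} → ExcludedMiddle ℓ) → ∀ x y → ¬ x ≤ y → y ≤ x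
≰⇒≥ em x y x≰y {q} q∈y with em {P = q ∈ cut x}
... | yes q∈x = q∈x
... | no q∉x = contradiction (λ {r} → x≤y {r}) x≰y
  where
  x≤y : x ≤ y
  x≤y {r} r∈x with ℚ.<-cmp r q
  ... | tri< r<q _ _  = downward y r<q q∈y
  ... | tri≈ _ refl _ = q∈y
  ... | tri> _ _ q<r  = contradiction (downward x q<r r∈x) q∉x

-- Subsets given by decidable predicates

∈-tabulate⁻ : ∀ {n p} {P : Fin n → Set p} (P? : ∀ i → Dec (P i)) {i} → i ∈ₛ tabulate (does ∘ P?) → P i
∈-tabulate⁻ P? {i} i∈ = does⇒ (P? i) (trans (sym (lookup∘tabulate (does ∘ P?) i)) ([]=⇒lookup i∈))
  where
  does⇒ : ∀ {p} {P : Set p} (P? : Dec P) → does P? ≡ inside → P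
  does⇒ (yes p) _ = p

∣tabulate∣ : ∀ {n p} {P : Fin n → Set p} (P? : ∀ i → Dec (P i)) →
             ∣ tabulate (does ∘ P?) ∣ ≡ sum λ i → ⟦ P? i ⟧
∣tabulate∣ {zero}  P? = refl
∣tabulate∣ {suc n} P? with P? zero
... | yes _ = cong suc (∣tabulate∣ (P? ∘ suc))
... | no _  = ∣tabulate∣ (P? ∘ suc)

-- Boxes, colours and bad triples

-- The number of vertices that `monochromatic-path` asks for when there are `2 ^ d * 2 ^ d` colours,
-- one bit for each of the `2d` bounds.
sampleSize : ℕ → ℕ
sampleSize d = suc (2 ^ (2 ^ d * 2 ^ d))

module _ (em : ∀ {ℓ} → ExcludedMiddle ℓ) where

  -- A bit is set when the bound of `B′` is at most as strict as that of `B`; hence the opposite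
  -- orders for `lo` and `hi`.
  colour : ∀ {d} → Box d → Box d → Fin (2 ^ d * 2 ^ d)
  colour B B′ = combine (funToFin λ t → bit (em {P = lo (B′ t) ≤ lo (B t)}))
                        (funToFin λ t → bit (em {P = hi (B t) ≤ hi (B′ t)}))

  -- Each of the 2d bounds changes in the same direction from B to B′ as from B′
  -- to B″, so no bound of B′ is stricter than those of both B and B″.
  between : ∀ {d} {B B′ B″ : Box d} → colour B B′ ≡ colour B′ B″ →
            ∀ {p} → p ∈ᵇ B → p ∈ᵇ B″ → p ∈ᵇ B′
  between {B = B} {B′} {B″} eq {p} p∈B p∈B″ t =
    let (los , his) = Fin.combine-injective _ _ _ _ eq
    in bit-cases {R = lo (B′ t) ≤ p t} (funToFin-injective los t)
         (λ B′≤B {q} q∈ → proj₁ (p∈B t) (B′≤B q∈))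
         (λ B″≰B′ {q} q∈ → proj₁ (p∈B″ t) (≰⇒≥ em (lo (B″ t)) (lo (B′ t)) B″≰B′ q∈))
     , bit-cases {R = p t ≤ hi (B′ t)} (funToFin-injective his t)
         (λ B≤B′ {q} q∈ → B≤B′ (proj₂ (p∈B t) q∈))
         (λ B′≰B″ {q} q∈ → ≰⇒≥ em (hi (B′ t)) (hi (B″ t)) B′≰B″ (proj₂ (p∈B″ t) q∈))

  module _ {s} {d n} (S : Pred (ℝ^ d) s) (F : Vector (Box d) n) where

    -- With `x ≢ z` this matches the count in `ordered-pairs`; the diagonal pairs become unjoined.
    Joined : Fin n → Fin n → Set _
    Joined x z = x ≢ z × Intersecting S F (⁅ x ⁆ ∪ ⁅ z ⁆)

    joined? : ∀ x z → Dec (Joined x z)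
    joined? x z = em

    -- The decision carries the chosen point, which thus depends on `x` and `z` but not on `y`. The
    -- value 1 for an unjoined pair makes all its triples bad.
    hits : ∀ {x z} → Dec (Joined x z) → Fin n → ℕ
    hits (yes (_ , p , _)) y = ⟦ em {P = p ∈ᵇ F y} ⟧
    hits (no _)            y = 1

    bad : Vec (Fin n) 3 → ℕ
    bad (x ∷ y ∷ z ∷ []) = hits (joined? x z) y

    1≤hits : ∀ {x y z} (xz? : Dec (Joined x z)) → colour (F x) (F y) ≡ colour (F y) (F z) → 1 ℕ.≤ hits xz? y
    1≤hits {x} {y} {z} (yes (_ , p , _ , p∈F)) eq = ℕ.≤-reflexive (sym (⟦⟧-true
      (between {B = F x} {F y} {F z} eq {p}
        (p∈F x (Subset.x∈p∪q⁺ (inj₁ (Subset.x∈⁅x⁆ x))))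
        (p∈F z (Subset.x∈p∪q⁺ (inj₂ (Subset.x∈⁅x⁆ z)))))))
    1≤hits (no _) eq = ℕ.≤-refl

    -- The path is found among positions of `v`. Repeated entries do no harm: if `x` and `z`
    -- coincide, the pair is unjoined and the triple is bad.
    bad-subvector : (v : Vec (Fin n) (sampleSize d)) → 1 ℕ.≤ sumSub 3 bad v
    bad-subvector v =
      let (i , j , k , i<j , j<k , eq) = monochromatic-path λ i j → colour (F (lookup v i)) (F (lookup v j))
      in ℕ.≤-trans (1≤hits {lookup v i} {lookup v j} {lookup v k} (joined? _ _) eq)
           (sumSub-term₃ bad v i<j j<k)

    module _ {N} (small : ∀ I → Intersecting S F I → N * ∣ I ∣ ℕ.≤ n) where

      -- For a joined pair, the boxes through its point form an S-intersecting subfamily, so `small`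
      -- applies. For an unjoined pair all `n` boxes count, which the second summand covers.
      few-hits : ∀ {x z} (xz? : Dec (Joined x z)) → N * sum (hits xz?) ℕ.≤ n ℕ.+ n * (N * ⟦ ¬? xz? ⟧)
      few-hits (yes (_ , p , p∈S , _)) = begin
        N * sum (λ y → ⟦ em {P = p ∈ᵇ F y} ⟧) ≡⟨ cong (N *_) (∣tabulate∣ (λ y → em {P = p ∈ᵇ F y})) ⟨
        N * ∣ I ∣                              ≤⟨ small I (p , p∈S , λ y → ∈-tabulate⁻ (λ y → em {P = p ∈ᵇ F y})) ⟩
        n                                      ≤⟨ ℕ.m≤m+n n _ ⟩
        n ℕ.+ n * (N * 0)                      ∎
        where
        open ℕ.≤-Reasoning
        I = tabulate λ y → does (em {P = p ∈ᵇ F y})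
      few-hits (no _) = begin
        N * sum {n} (λ _ → 1)  ≡⟨ cong (N *_) (sum-const n 1) ⟩
        N * (n * 1)            ≡⟨ solve 2 (λ N n → N :* (n :* con 1) := n :* (N :* con 1)) refl N n ⟩
        n * (N * 1)            ≤⟨ ℕ.m≤n+m _ n ⟩
        n ℕ.+ n * (N * 1)      ∎
        where
        open ℕ.≤-Reasoning
        open +-*-Solver using (solve; _:=_; _:+_; _:*_; con)

      few-bad : N * sumVec 3 bad ℕ.≤ n ^ 3 ℕ.+ n * (N * sum λ x → sum λ z → ⟦ ¬? (joined? x z) ⟧)
      few-bad = begin
        N * sum (λ x → sum λ y → sum λ z → h x z y)
          -- With `y` innermost, each inner sum concerns a single pair `(x , z)`.
          ≡⟨ cong (N *_) (sum-cong-≗ λ x → ∑-comm (λ y z → h x z y)) ⟩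
        N * sum (λ x → sum λ z → sum λ y → h x z y)
          ≡⟨ trans (*-distribˡ-sum N (λ x → sum λ z → sum (h x z)))
               (sum-cong-≗ λ x → *-distribˡ-sum N (λ z → sum (h x z))) ⟩
        sum (λ x → sum λ z → N * sum λ y → h x z y)
          ≤⟨ sum-mono-≤ (λ x → sum-mono-≤ λ z → few-hits (joined? x z)) ⟩
        sum (λ x → sum λ z → n ℕ.+ n * (N * b x z))
          ≡⟨ trans (sum-cong-≗ λ x → ∑-distrib-+ (λ _ → n) (λ z → n * (N * b x z)))
               (∑-distrib-+ {n} (λ _ → sum {n} λ _ → n) (λ x → sum λ z → n * (N * b x z))) ⟩
        sum {n} (λ x → sum {n} λ z → n) ℕ.+ sum (λ x → sum λ z → n * (N * b x z))
          ≡⟨ cong₂ ℕ._+_ n³ linear ⟩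
        n ^ 3 ℕ.+ n * (N * sum λ x → sum λ z → b x z) ∎
        where
        open ℕ.≤-Reasoning
        h = λ x z → hits (joined? x z)
        b = λ x z → ⟦ ¬? (joined? x z) ⟧
        n³ : sum {n} (λ x → sum {n} λ z → n) ≡ n ^ 3
        n³ = trans (sum-cong-≗ {n} λ _ → sum-const n n)
               (trans (sum-const n (n * n)) (cong (λ e → n * (n * e)) (sym (ℕ.*-identityʳ n))))
        pull : ∀ c → (sum λ x → sum λ z → c * b x z) ≡ c * sum λ x → sum λ z → b x z
        pull c = sym (trans (*-distribˡ-sum c (λ x → sum (b x))) (sum-cong-≗ λ x → *-distribˡ-sum c (b x)))
        linear : (sum λ x → sum λ z → n * (N * b x z)) ≡ n * (N * sum λ x → sum λ z → b x z)
        linear = trans (sum-cong-≗ λ x → sum-cong-≗ λ z → sym (ℕ.*-assoc n N (b x z)))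
                   (trans (pull (n * N)) (ℕ.*-assoc n N _))

    -- Joined and unjoined ordered pairs total `n * n`, which is `2 * (n C 2) + n`. The joined ones
    -- take up all but `n * n + M * n` of `suc M * (n * n)`, and `M ≤ n` absorbs the diagonal term
    -- `M * n`. Adding `M * (2 * (n C 2))` to both sides replaces subtraction.
    few-unjoined : ∀ {M L} → M * (n C 2) ℕ.≤ suc M * L → M ℕ.≤ n →
      2 * L ℕ.≤ (sum λ x → sum λ z → ⟦ joined? x z ⟧) →
      suc M * (sum λ x → sum λ z → ⟦ ¬? (joined? x z) ⟧) ℕ.≤ 2 * (n * n)
    few-unjoined {M} {L} pairs M≤n 2L≤A = ℕ.+-cancelʳ-≤ (M * (2 * (n C 2))) _ _ $ begin
      suc M * B ℕ.+ M * (2 * (n C 2))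
        ≡⟨ cong (suc M * B ℕ.+_) (solve 2 (λ M c → M :* (con 2 :* c) := con 2 :* (M :* c)) refl M (n C 2)) ⟩
      suc M * B ℕ.+ 2 * (M * (n C 2))
        ≤⟨ ℕ.+-monoʳ-≤ (suc M * B) (ℕ.*-monoʳ-≤ 2 pairs) ⟩
      suc M * B ℕ.+ 2 * (suc M * L)
        ≡⟨ solve 3 (λ N b l → N :* b :+ con 2 :* (N :* l) := N :* (con 2 :* l :+ b)) refl (suc M) B L ⟩
      suc M * (2 * L ℕ.+ B)
        ≤⟨ ℕ.*-monoʳ-≤ (suc M) (ℕ.+-monoˡ-≤ B 2L≤A) ⟩
      suc M * (A ℕ.+ B)
        ≡⟨ cong (suc M *_) A+B≡n² ⟩
      suc M * (n * n)
        ≡⟨ cong (λ e → n * n ℕ.+ M * e) (2*nC2+n≡n² n) ⟨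
      n * n ℕ.+ M * (2 * (n C 2) ℕ.+ n)
        ≡⟨ solve 3 (λ n M c → n :* n :+ M :* (con 2 :* c :+ n) := n :* n :+ M :* n :+ M :* (con 2 :* c))
             refl n M (n C 2) ⟩
      n * n ℕ.+ M * n ℕ.+ M * (2 * (n C 2))
        ≤⟨ ℕ.+-monoˡ-≤ (M * (2 * (n C 2))) (ℕ.+-monoʳ-≤ (n * n) (ℕ.*-monoˡ-≤ n M≤n)) ⟩
      n * n ℕ.+ n * n ℕ.+ M * (2 * (n C 2))
        ≡⟨ cong (λ e → n * n ℕ.+ e ℕ.+ M * (2 * (n C 2))) (ℕ.+-identityʳ (n * n)) ⟨
      2 * (n * n) ℕ.+ M * (2 * (n C 2)) ∎
      where
      open ℕ.≤-Reasoning
      open +-*-Solver using (solve; _:=_; _:+_; _:*_; con)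
      A = sum λ x → sum λ z → ⟦ joined? x z ⟧
      B = sum λ x → sum λ z → ⟦ ¬? (joined? x z) ⟧
      A+B≡n² : A ℕ.+ B ≡ n * n
      A+B≡n² = trans (sym (∑-distrib-+ (λ x → sum λ z → ⟦ joined? x z ⟧) _))
        (trans (sum-cong-≗ λ x → trans (sym (∑-distrib-+ (λ z → ⟦ joined? x z ⟧) _))
                                   (trans (sum-cong-≗ λ z → ⟦⟧-complement (joined? x z))
                                   (trans (sum-const n 1) (ℕ.*-identityʳ n))))
               (sum-const n n))

-- Opaque because type checking is very slow once it unfolds inside the gcds of
-- fractions with denominator suc (sparsity d).
opaque

  sparsity : ℕ → ℕ
  sparsity d = suc (3 * (sampleSize d C 3))

  0<sparsity : ∀ d → 0 ℕ.< sparsity d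
  0<sparsity d = s≤s z≤n

  3*C<sparsity : ∀ d → 3 * (sampleSize d C 3) ℕ.< sparsity d
  3*C<sparsity d = ℕ.n<1+n _

-- The theorem in natural numbers

module _ (em : ∀ {ℓ} → ExcludedMiddle ℓ) {s} {d} (S : Pred (ℝ^ d) s) where

  -- If every S-intersecting subfamily were smaller, the number `T` of bad triples would satisfy
  -- `N * T ≤ 3 * n ^ 3`, one part from points and two from unjoined pairs. As `n ^ 3 ≤ c * T`, this
  -- gives `N ≤ 3 * c`, against the choice of `sparsity`.
  large-subfamily : ∀ {n} .{{_ : NonZero n}} (F : Vector (Box d) n) {Ps} → Unique Ps →
    All (λ P → ∣ P ∣ ≡ 2 × Intersecting S F P) Ps →
    sparsity d * (n C 2) ℕ.< suc (sparsity d) * length Ps →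
    ∃ λ I → Intersecting S F I × n ℕ.≤ suc (sparsity d) * ∣ I ∣
  large-subfamily F {[]} _ _ many =
    contradiction (ℕ.≤-trans many (ℕ.≤-reflexive (ℕ.*-zeroʳ (suc (sparsity d))))) λ ()
  large-subfamily {n} F {Ps@(P ∷ _)} Ps! Ps-pairs@((∣P∣≡2 , P-meets) ∷ _) many
    with em {P = ∃ λ I → Intersecting S F I × n ℕ.≤ suc (sparsity d) * ∣ I ∣}
  ... | yes found = found
  ... | no ¬found = contradiction
    (ℕ.*-cancelʳ-≤ N (3 * c) (n ^ 3) {{ℕ.m^n≢0 n 3}} bound)
    (ℕ.<⇒≱ (ℕ.m<n⇒m<1+n (3*C<sparsity d)))
    where
    open ℕ.≤-Reasoning
    open +-*-Solver using (solve; _:=_; _:+_; _:*_; con)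
    M = sparsity d
    N = suc M
    c = sampleSize d C 3
    T = sumVec 3 (bad em S F)

    small : ∀ I → Intersecting S F I → N * ∣ I ∣ ℕ.≤ n
    small I I-meets = ℕ.≰⇒≥ λ n≤ → ¬found (I , I-meets , n≤)

    -- The listed pair `P` is itself S-intersecting, so `small` already forces `n` to be at least
    -- `2 * N`.
    M≤n : M ℕ.≤ n
    M≤n = begin
      M         ≤⟨ ℕ.n≤1+n M ⟩
      N         ≤⟨ ℕ.m≤m*n N 2 ⟩
      N * 2     ≡⟨ cong (N *_) ∣P∣≡2 ⟨
      N * ∣ P ∣ ≤⟨ small P P-meets ⟩
      n         ∎

    bound : N * n ^ 3 ℕ.≤ 3 * c * n ^ 3
    bound = begin
      N * n ^ 3
        ≤⟨ ℕ.*-monoʳ-≤ N (averaging 3 (sampleSize d) (bad em S F) (bad-subvector em S F)) ⟩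
      N * (c * T)
        ≡⟨ solve 3 (λ N c t → N :* (c :* t) := c :* (N :* t)) refl N c T ⟩
      c * (N * T)
        ≤⟨ ℕ.*-monoʳ-≤ c (few-bad em S F {N} small) ⟩
      c * (n ^ 3 ℕ.+ n * (N * _))
        ≤⟨ ℕ.*-monoʳ-≤ c (ℕ.+-monoʳ-≤ (n ^ 3) (ℕ.*-monoʳ-≤ n
             (few-unjoined em S F (ℕ.<⇒≤ many) M≤n (ordered-pairs em (Intersecting S F) Ps! Ps-pairs)))) ⟩
      c * (n ^ 3 ℕ.+ n * (2 * (n * n)))
        ≡⟨ solve 2 (λ n c → c :* (n :* (n :* (n :* con 1)) :+ n :* (con 2 :* (n :* n)))
                         := con 3 :* c :* (n :* (n :* (n :* con 1)))) refl n c ⟩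
      3 * c * n ^ 3 ∎

-- From real proportions to natural numbers

pairs-exist : ∀ n → ∃ λ m → suc (suc n) C 2 ≡ suc m
pairs-exist n with suc (suc n) C 2 in eq
... | suc m = m , refl
-- Without pairs, `2*nC2+n≡n²` would equate a number that is at least 2 with its square.
... | zero  = contradiction
  (trans (cong (λ e → 2 * e ℕ.+ suc (suc n)) (sym eq)) (2*nC2+n≡n² (suc (suc n))))
  (ℕ.<⇒≢ (ℕ.m<m*n (suc (suc n)) (suc (suc n)) (s≤s (s≤s z≤n))))

-- The cut of `fromℕ L` consists of the rationals strictly below `L`; clearing the denominator
-- `suc M` keeps the inequality strict.
many-pairs : ∀ M x n L → frac M M ∈ cut x → (suc (suc n) C 2) · x ≤ fromℕ L →
             M * (suc (suc n) C 2) ℕ.< suc M * L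
many-pairs M x n L M/N∈x pairs with pairs-exist n
... | m , eq = subst₂ ℕ._<_ left (ℕ.*-comm L (suc M))
  (frac-cancel-< (suc m * M) M L 0
    (pairs (subst (λ e → frac (suc m * M) M ∈ cut (e · x)) (sym eq) (·-lower x M M m M/N∈x))))
  where
  left : suc m * M * 1 ≡ M * (suc (suc n) C 2)
  left = trans (ℕ.*-identityʳ (suc m * M)) (trans (ℕ.*-comm (suc m) M) (cong (M *_) (sym eq)))

theorem1p1 : (∀ {ℓ} → ExcludedMiddle ℓ) → ∀ {s : Level} (d : ℕ) → .{{_ : NonZero d}} →
    Σ ℝ λ c → 0ℝ < c × c < 1ℝ ×
    Σ (⟨ c ,1] ⟶ₛ ⟨ 0ℝ ,1]) λ β →
    ∀ (S : Pred (ℝ^ d) s) → S Respects _≋_ → Satisfiable S →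
    ∀ (α : Setoid.Carrier ⟨ c ,1]) (n : ℕ) → n ≢ 1 → (F : Vector (Box d) n) →
    IntersectingPairs≥ S F ((n C 2) · proj₁ α) →
    ∃ λ (I : Subset n) → Intersecting S F I × n · proj₁ (β ⟨$⟩ α) ≤ fromℕ ∣ I ∣
theorem1p1 em {s} d = fromℚ (frac M M)
  , (ℚ.0ℚ , ℚ.<-irrefl refl , 0<frac (sparsity d) (0<sparsity d))
  , (frac M M , ℚ.<-irrefl refl , frac-mono-< M M 1 0
      (subst₂ ℕ._<_ (sym (ℕ.*-identityʳ M)) (sym (ℕ.*-identityˡ (suc M))) (ℕ.n<1+n M)))
  , β , large
  where
  -- The threshold is `M / (M + 1)`: for `α` above it, fewer than one in `M + 1` of the pairs fail
  -- to be S-intersecting.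
  M = sparsity d

  0<frac : ∀ a → 0 ℕ.< a → ℚ.0ℚ ℚ.< frac a M
  0<frac a 0<a = frac-mono-< 0 0 a M (ℕ.<-≤-trans 0<a (ℕ.≤-reflexive (sym (ℕ.*-identityʳ a))))

  -- Constant, because the proportion `1 / (M + 1)` from `large-subfamily` serves every `α` above
  -- the threshold.
  β : ⟨ fromℚ (frac M M) ,1] ⟶ₛ ⟨ 0ℝ ,1]
  β = record
    { to   = λ _ → fromℚ (frac 1 M) , (ℚ.0ℚ , ℚ.<-irrefl refl , 0<frac 1 (s≤s z≤n))
                 , λ q<1/N → ℚ.<-≤-trans q<1/N (frac-mono-≤ 1 M 1 0 (s≤s z≤n))
    ; cong = λ _ → id , id
    }

  large : ∀ (S : Pred (ℝ^ d) s) → S Respects _≋_ → Satisfiable S →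
    ∀ (α : Setoid.Carrier ⟨ fromℚ (frac M M) ,1]) (n : ℕ) → n ≢ 1 → (F : Vector (Box d) n) →
    IntersectingPairs≥ S F ((n C 2) · proj₁ α) →
    ∃ λ (I : Subset n) → Intersecting S F I × n · fromℚ (frac 1 M) ≤ fromℕ ∣ I ∣
  -- For the empty family, any point of `S` witnesses that the empty subfamily is S-intersecting.
  large S _ (x , x∈S) _ zero _ F _ = [] , (x , x∈S , λ ()) , id
  -- A single box has no pairs, so the count of pairs could not tell whether it meets `S`.
  large S _ _ _ (suc zero) n≢1 F _ = contradiction refl n≢1
  large S _ _ (α , (q , q≮c , q∈α) , _) n@(suc (suc k)) _ F (Ps , Ps! , Ps-pairs , pairs) =
    let (I , I-meets , n≤) = large-subfamily em S F Ps! Ps-pairs (many-pairs M α k (length Ps) c∈α pairs)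
    in I , I-meets , λ q∈ → ℚ.<-≤-trans (·-upper M n q∈) (frac-mono-≤ n M ∣ I ∣ 0
         (subst₂ ℕ._≤_ (sym (ℕ.*-identityʳ n)) (ℕ.*-comm (suc M) ∣ I ∣) n≤))
    where
    -- The witness `q` of `c < α` lies outside the cut of `c`, so it is at least `c`, and the cut of
    -- `α` is closed downward.
    c∈α : frac M M ∈ cut α
    c∈α with ℚ.<-cmp (frac M M) q
    ... | tri< c<q _ _  = downward α c<q q∈α
    ... | tri≈ _ refl _ = q∈α
    ... | tri> _ _ q<c  = contradiction q<c q≮c
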